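{- Let $G$ be a simple, undirected, finite graph with $n\geq 1$ vertices and let $k$ be a positive integer. For every initial configuration $x(0)$ of the $k$-reversible process on $G$, the transient length satisfies $\tau(x(0))\leq E(t_{\max})+n-1$, where $t_{\max}$ is a time such that $E(t)=E(t_{\max})$ for all $t\geq t_{\max}$.
   Context: Let $V(G)=\{v_1,\dots,v_n\}$. A configuration is an assignment of a state in $\{ -1,+1\}$ to each vertex. In the $k$-reversible process on $G$ with initial configuration $x(0)$, $x_i(t)$ denotes the state of $v_i$ at discrete time $t=0,1,2,\dots$, and $x(t)=(x_1(t),\dots,x_n(t))$. Let $\mathit{op}_i(t)$ be the number of neighbors of $v_i$ whose state at time $t$ is different from $x_i(t)$. All vertices are updated simultaneously: $x_i(t+1)=-x_i(t)$ if $\mathit{op}_i(t)\geq k$, and $x_i(t+1)=x_i(t)$ otherwise. The period length $p(x(0))\ge 1$ and the transient length $\tau(x(0))\geq 0$ are the integers such that: $x(t+p(x(0)))=x(t)$ for all $t\geq\tau(x(0))$; and, for integers $t\ge 0$ and $q\geq 1$, $x(t+q)\neq x(t)$ whenever $t<\tau(x(0))$ or $q<p(x(0))$. Let $S_1(t)=\{v_i \mid \mathit{op}_i(t)\geq k\}$ and $S_2(t)=\{v_i\mid \mathit{op}_i(t)<k\}$. The energy function is $$E(t)=\sum_{v_i\in S_1(t)}(\mathit{op}_i(t)-k)+\sum_{v_i\in S_2(t)}(k-\mathit{op}_i(t)).$$ The function $E$ is monotonically nondecreasing in $t$ and, as $G$ is finite, bounded; hence (for each $x(0)$) there is a time $t_{\max}$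 such that $E(t)=E(t_{\max})$ for all $t\geq t_{\max}$, and the value $E(t_{\max})$ does not depend on the choice of such a time. -}

module Defs where

open import Data.Fin.Base using (Fin)
open import Data.List.Base using (List; allFin; filter; length; map; sum)
open import Data.Nat.Base using (ℕ; zero; suc; _+_; _∸_; _≤_; _<_)
open import Data.Nat.Properties using (_≤?_; _<?_)
open import Data.Sign.Base using (Sign; opposite)
open import Data.Sign.Properties using (_≟_)
open import Data.Sum.Base using (_⊎_)
open import Data.Vec.Base using (Vec; lookup; tabulate)
open import Relation.Binary.Core using (Rel)
open import Relation.Binary.Definitions using (Decidable; Irreflexive; Symmetric)
open import Relation.Binary.PropositionalEquality.Core using (_≡_; _≢_)
open import Relation.Nullary.Decidable using (_×-dec_; ¬?; does)
open import Data.Bool.Base using (if_then_else_)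
open import Level using (0ℓ)

record SimpleGraph (n : ℕ) : Set₁ where
  field
    Adj    : Rel (Fin n) 0ℓ
    adj?   : Decidable Adj
    sym    : Symmetric Adj
    irrefl : Irreflexive _≡_ Adj

-- The states -1 and +1 are the two elements of Sign. Configurations are
-- vectors rather than functions so that x(t) = x(s) can be stated with _≡_.
Configuration : ℕ → Set
Configuration = Vec Sign

module Process {n : ℕ} (G : SimpleGraph n) (k : ℕ) where
  open SimpleGraph G

  op : Configuration n → Fin n → ℕ
  op x i = length
    (filter (λ j → adj? i j ×-dec ¬? (lookup x j ≟ lookup x i)) (allFin n))

  step : Configuration n → Configuration n
  step x = tabulate λ i →
    if does (k ≤? op x i) then opposite (lookup x i) else lookup x i

  config : Configuration n → ℕ → Configuration n
  config x₀ zero    = x₀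
  config x₀ (suc t) = step (config x₀ t)

  S₁ : Configuration n → ℕ → List (Fin n)
  S₁ x₀ t = filter (λ i → k ≤? op (config x₀ t) i) (allFin n)

  S₂ : Configuration n → ℕ → List (Fin n)
  S₂ x₀ t = filter (λ i → op (config x₀ t) i <? k) (allFin n)

  -- Neither subtraction truncates, by membership in S₁ and S₂ respectively.
  E : Configuration n → ℕ → ℕ
  E x₀ t = sum (map (λ i → op (config x₀ t) i ∸ k) (S₁ x₀ t))
         + sum (map (λ i → k ∸ op (config x₀ t) i) (S₂ x₀ t))

  record IsPeriodAndTransient (x₀ : Configuration n) (p τ : ℕ) : Set where
    field
      p≥1      : 1 ≤ p
      periodic : ∀ t → τ ≤ t → config x₀ (t + p) ≡ config x₀ t
      minimal  : ∀ t q → 1 ≤ q → t < τ ⊎ q < p →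
                 config x₀ (t + q) ≢ config x₀ t

  EnergyConstantFrom : Configuration n → ℕ → Set
  EnergyConstantFrom x₀ tmax = ∀ t → tmax ≤ t → E x₀ t ≡ E x₀ tmax

{-# OPTIONS --safe #-}

-- Put Φ(x) = Σᵢ (opᵢ ∸ k + 1 if vᵢ flips, k ∸ opᵢ otherwise), which is the
-- energy plus the number of flips, or, up to the constant n/2, the energy for
-- the threshold k − ½.  Up to terms symmetric in x and y, Φ(x) is the number of
-- ordered adjacent pairs (i , j) with yᵢ = xⱼ, where y is the successor of x,
-- and the successor maximises the resulting expression in x and y over all y.
-- Comparing the successor z of y with the competitor x gives Φ(y) ≥ Φ(x), and
-- as the half-integral threshold has no ties, Φ grows by at least the number of
-- vertices where z and x differ.  Before the transient ends z ≠ x, and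
-- n ≤ Φ ≤ E + n, hence even τ ≤ E(tmax).

module Submission where

open import Algebra.Properties.CommutativeMonoid.Sum
  using (sum; ∑-distrib-+; ∑-comm; sum-cong-≗)
open import Data.Bool.Base using (Bool; true; false; if_then_else_)
open import Data.Fin.Base using (Fin; zero; suc)
open import Data.List.Base as List using (filter; length)
open import Data.Nat.Base
  using (ℕ; zero; suc; _+_; _∸_; _≤_; _<_; _≤ᵇ_; _<ᵇ_; z≤n; s≤s)
import Data.Nat.ListAction as ℕList
open import Data.Nat.Properties
open import Data.Nat.Tactic.RingSolver using (solve-∀)
open import Data.Product.Base using (_,_)
open import Data.Sign.Base as Sign using (Sign; opposite)
open import Data.Sign.Properties using () renaming (_≟_ to _≟ˢ_)
open import Data.Sum.Base using (inj₁)
open import Data.Vec.Base using (Vec; []; _∷_; lookup)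
open import Data.Vec.Properties using (lookup∘tabulate)
open import Function.Base using (_∘_; id)
open import Function.Bundles using (mk⇔)
open import Relation.Binary.PropositionalEquality
  using (_≡_; _≢_; refl; sym; trans; cong; cong₂; subst; module ≡-Reasoning)
open import Relation.Nullary
  using (Dec; yes; no; does; ¬?; _×-dec_; contradiction)
open import Relation.Nullary.Decidable using (does-⇔)
open import Relation.Nullary.Reflects using (ofʸ; ofⁿ)
open import Relation.Unary using (Pred; Decidable)

open import Defs

-- Finite sums of natural numbers.

-- Opaque so that unification can read the summand off a sum.
opaque
  ∑ : ∀ {n} → (Fin n → ℕ) → ℕ
  ∑ = sum +-0-commutativeMonoid

  ∑-cong : ∀ {n} {f g : Fin n → ℕ} → (∀ i → f i ≡ g i) → ∑ f ≡ ∑ g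
  ∑-cong = sum-cong-≗ +-0-commutativeMonoid

  ∑-+ : ∀ {n} (f g : Fin n → ℕ) → ∑ (λ i → f i + g i) ≡ ∑ f + ∑ g
  ∑-+ = ∑-distrib-+ +-0-commutativeMonoid

  ∑-mono-≤ : ∀ {n} {f g : Fin n → ℕ} → (∀ i → f i ≤ g i) → ∑ f ≤ ∑ g
  ∑-mono-≤ {zero}  f≤g = z≤n
  ∑-mono-≤ {suc n} f≤g = +-mono-≤ (f≤g zero) (∑-mono-≤ (f≤g ∘ suc))

  ∑-swap : ∀ {m n} (f : Fin m → Fin n → ℕ) → ∑ (λ i → ∑ (f i)) ≡ ∑ (λ j → ∑ (λ i → f i j))
  ∑-swap = ∑-comm +-0-commutativeMonoid

  ∑-one : ∀ n → ∑ {n} (λ _ → 1) ≡ n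
  ∑-one zero    = refl
  ∑-one (suc n) = cong suc (∑-one n)

⟦_⟧ : Bool → ℕ
⟦ b ⟧ = if b then 1 else 0

module _ {a p} {A : Set a} {P : Pred A p} (P? : Decidable P) where

  opaque
    unfolding ∑

    -- `allFin n` is `tabulate id`, whose tail is not an `allFin` again; a general `g` lets the
    -- induction pass.
    length-filter-tabulate : ∀ {n} (g : Fin n → A) →
      length (filter P? (List.tabulate g)) ≡ ∑ λ i → ⟦ does (P? (g i)) ⟧
    length-filter-tabulate {zero}  g = refl
    length-filter-tabulate {suc n} g with does (P? (g zero))
    ... | true  = cong suc (length-filter-tabulate (g ∘ suc))
    ... | false = length-filter-tabulate (g ∘ suc)

    sum-map-filter-tabulate : ∀ (f : A → ℕ) {n} (g : Fin n → A) →
      ℕList.sum (List.map f (filter P? (List.tabulate g)))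
        ≡ ∑ λ i → if does (P? (g i)) then f (g i) else 0
    sum-map-filter-tabulate f {zero}  g = refl
    sum-map-filter-tabulate f {suc n} g with does (P? (g zero))
    ... | true  = cong (f (g zero) +_) (sum-map-filter-tabulate f (g ∘ suc))
    ... | false = sum-map-filter-tabulate f (g ∘ suc)

-- Hamming distance.
distance : ∀ {n} → Vec Sign n → Vec Sign n → ℕ
distance x z = ∑ λ i → ⟦ does (¬? (lookup x i ≟ˢ lookup z i)) ⟧

opaque
  unfolding ∑

  distance-positive : ∀ {n} (x z : Vec Sign n) → x ≢ z → 1 ≤ distance x z
  distance-positive []      []      x≢z = contradiction refl x≢z
  distance-positive (a ∷ x) (b ∷ z) x≢z with a ≟ˢ b
  ... | yes refl = distance-positive x z (x≢z ∘ cong (a ∷_))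
  ... | no _     = s≤s z≤n

-- The update rule at a single vertex.

module LocalRule (k : ℕ) where

  next : ℕ → Sign → Sign
  next o u = if does (k ≤? o) then opposite u else u

  -- This is |o - (k - ½)| + ½, hence never zero.
  φ : ℕ → ℕ
  φ o = if does (k ≤? o) then suc (o ∸ k) else k ∸ o

  -- gain and cost are the symmetric terms by which φ differs from the number
  -- of neighbours agreeing with the next state, moved to the two sides so that
  -- no subtraction occurs.
  gain : Sign → Sign → ℕ
  gain u s = if does (u ≟ˢ s) then k else 1

  cost : ℕ → Sign → Sign → ℕ
  cost d u s = if does (u ≟ˢ s) then d else k

  gain-sym : ∀ u s → gain u s ≡ gain s u
  gain-sym u s = cong (if_then k else 1) (does-⇔ (mk⇔ sym sym) (u ≟ˢ s) (s ≟ˢ u))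

  cost-sym : ∀ d u s → cost d u s ≡ cost d s u
  cost-sym d u s = cong (if_then d else k) (does-⇔ (mk⇔ sym sym) (u ≟ˢ s) (s ≟ˢ u))

  flip-balance : ∀ {o} → k ≤ o → suc (o ∸ k) + k ≡ o + 1
  flip-balance {o} k≤o = trans (cong suc (m∸n+n≡m k≤o)) (sym (+-comm o 1))

  stay-balance : ∀ a {o} → o < k → (k ∸ o) + (a + o) ≡ a + k
  stay-balance a {o} o<k = begin
    (k ∸ o) + (a + o) ≡⟨ rearrange (k ∸ o) a o ⟩
    a + (k ∸ o + o)   ≡⟨ cong (a +_) (m∸n+n≡m (<⇒≤ o<k)) ⟩
    a + k             ∎
    where
    open ≡-Reasoning
    rearrange : ∀ m a o → m + (a + o) ≡ a + (m + o)
    rearrange = solve-∀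

  -- The right side exceeds the left, without its last 1, by 2(k - o) - 1. In `stay-loses` the gap
  -- is 2(o - k) + 1. Both are odd, so the wrong choice costs at least one.
  flip-loses : ∀ {o} → o < k → o + 1 + 1 ≤ (k ∸ o) + k
  flip-loses {o} o<k = begin
    o + 1 + 1   ≡⟨ +-comm (o + 1) 1 ⟩
    1 + (o + 1) ≡⟨ cong suc (+-comm o 1) ⟩
    1 + suc o   ≤⟨ +-mono-≤ (m<n⇒0<n∸m o<k) o<k ⟩
    (k ∸ o) + k ∎
    where open ≤-Reasoning

  stay-loses : ∀ a {o} → k ≤ o → a + k + 1 ≤ suc (o ∸ k) + (a + o)
  stay-loses a {o} k≤o = begin
    a + k + 1             ≡⟨ +-comm (a + k) 1 ⟩
    1 + (a + k)           ≤⟨ s≤s (≤-trans (+-monoʳ-≤ a k≤o) (m≤n+m _ (o ∸ k))) ⟩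
    suc (o ∸ k) + (a + o) ∎
    where open ≤-Reasoning

  -- A s counts the neighbours in state s of a vertex in state u.
  next-balance : ∀ (A : Sign → ℕ) u → let o = A (opposite u); s = next o u in
    φ o + cost (A u + o) u s ≡ A s + gain u s
  -- `does (k ≤? o)` computes to `k ≤ᵇ o`, so abstracting this boolean settles `φ` and `next`
  -- together.
  next-balance A u with k ≤ᵇ A (opposite u) | ≤ᵇ-reflects-≤ k (A (opposite u))
  next-balance A Sign.- | true  | ofʸ k≤o = flip-balance k≤o
  next-balance A Sign.+ | true  | ofʸ k≤o = flip-balance k≤o
  next-balance A Sign.- | false | ofⁿ k≰o  = stay-balance (A Sign.-) (≰⇒> k≰o)
  next-balance A Sign.+ | false | ofⁿ k≰o  = stay-balance (A Sign.+) (≰⇒> k≰o)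

  -- With `cost` moved to the left, `φ o` bounds A s + gain - cost for both states `s`. By
  -- `next-balance` the state `next o u` attains it; the other one falls short by at least one.
  next-optimal : ∀ (A : Sign → ℕ) u s → let o = A (opposite u) in
    A s + gain u s + ⟦ does (¬? (s ≟ˢ next o u)) ⟧ ≤ φ o + cost (A u + o) u s
  next-optimal A u s with k ≤ᵇ A (opposite u) | ≤ᵇ-reflects-≤ k (A (opposite u))
  next-optimal A Sign.- Sign.- | true  | ofʸ k≤o = stay-loses (A Sign.-) k≤o
  next-optimal A Sign.+ Sign.+ | true  | ofʸ k≤o = stay-loses (A Sign.+) k≤o
  next-optimal A Sign.- Sign.+ | true  | ofʸ k≤o = ≤-reflexive (trans (+-identityʳ _) (sym (flip-balance k≤o)))
  next-optimal A Sign.+ Sign.- | true  | ofʸ k≤o = ≤-reflexive (trans (+-identityʳ _) (sym (flip-balance k≤o)))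
  next-optimal A Sign.- Sign.- | false | ofⁿ k≰o  = ≤-reflexive (trans (+-identityʳ _) (sym (stay-balance (A Sign.-) (≰⇒> k≰o))))
  next-optimal A Sign.+ Sign.+ | false | ofⁿ k≰o  = ≤-reflexive (trans (+-identityʳ _) (sym (stay-balance (A Sign.+) (≰⇒> k≰o))))
  next-optimal A Sign.- Sign.+ | false | ofⁿ k≰o  = flip-loses (≰⇒> k≰o)
  next-optimal A Sign.+ Sign.- | false | ofⁿ k≰o  = flip-loses (≰⇒> k≰o)

  φ-positive : ∀ o → 1 ≤ φ o
  φ-positive o with k ≤ᵇ o | ≤ᵇ-reflects-≤ k o
  ... | true  | ofʸ _   = s≤s z≤n
  ... | false | ofⁿ k≰o = m<n⇒0<n∸m (≰⇒> k≰o)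

  -- The conditional terms are the shares of one vertex in the sums over `S₁` and `S₂`; the final 1
  -- pays for a flip.
  φ-upper : ∀ o →
    φ o ≤ (if does (k ≤? o) then o ∸ k else 0) + (if does (o <? k) then k ∸ o else 0) + 1
  φ-upper o with k ≤ᵇ o | ≤ᵇ-reflects-≤ k o | o <ᵇ k | <ᵇ-reflects-< o k
  -- The two tests contradict each other here, but the bound holds all the same.
  ... | true  | ofʸ _   | true  | ofʸ _   = ≤-trans (s≤s (m≤m+n _ _)) (≤-reflexive (+-comm 1 _))
  ... | true  | ofʸ _   | false | ofⁿ _   = ≤-reflexive (trans (cong suc (sym (+-identityʳ _))) (+-comm 1 _))
  ... | false | ofⁿ _   | true  | ofʸ _   = m≤m+n _ 1
  ... | false | ofⁿ k≰o | false | ofⁿ o≮k = contradiction (≰⇒> k≰o) o≮k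

-- The potential of a configuration and its growth.

module Potential {n : ℕ} (G : SimpleGraph n) (k : ℕ) where
  open SimpleGraph G using (adj?) renaming (sym to adj-sym)
  open Process G k
  open LocalRule k

  agreeing : Configuration n → Fin n → Sign → ℕ
  agreeing x i s = ∑ λ j → ⟦ does (adj? i j ×-dec (lookup x j ≟ˢ s)) ⟧

  degree : Fin n → ℕ
  degree i = ∑ λ j → ⟦ does (adj? i j) ⟧

  op≡agreeing-opposite : ∀ x i → op x i ≡ agreeing x i (opposite (lookup x i))
  op≡agreeing-opposite x i =
    trans (length-filter-tabulate _ id) (∑-cong λ j → pointwise (adj? i j) (lookup x j) (lookup x i))
    where
    pointwise : ∀ {P : Set} (P? : Dec P) s u →
      ⟦ does (P? ×-dec ¬? (s ≟ˢ u)) ⟧ ≡ ⟦ does (P? ×-dec (s ≟ˢ opposite u)) ⟧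
    pointwise P? Sign.- Sign.- = refl
    pointwise P? Sign.- Sign.+ = refl
    pointwise P? Sign.+ Sign.- = refl
    pointwise P? Sign.+ Sign.+ = refl

  -- Replaces the two neighbour counts in `cost` by a number independent of the configuration, so
  -- that `totalCost` is symmetric.
  degree-split : ∀ x i s → agreeing x i s + agreeing x i (opposite s) ≡ degree i
  degree-split x i s =
    trans (sym (∑-+ _ _)) (∑-cong λ j → pointwise (adj? i j) (lookup x j) s)
    where
    pointwise : ∀ {P : Set} (P? : Dec P) s u →
      ⟦ does (P? ×-dec (s ≟ˢ u)) ⟧ + ⟦ does (P? ×-dec (s ≟ˢ opposite u)) ⟧ ≡ ⟦ does P? ⟧
    pointwise P? s u with does P?
    pointwise P? Sign.- Sign.- | true  = refl
    pointwise P? Sign.- Sign.+ | true  = refl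
    pointwise P? Sign.+ Sign.- | true  = refl
    pointwise P? Sign.+ Sign.+ | true  = refl
    pointwise P? s u | false = refl

  agreement : Configuration n → Configuration n → ℕ
  agreement x y = ∑ λ i → agreeing x i (lookup y i)

  -- Exchange the two summations and reverse each adjacency; this rests on the graph being
  -- undirected.
  agreement-sym : ∀ x y → agreement x y ≡ agreement y x
  agreement-sym x y = trans (∑-swap _) (∑-cong λ j → ∑-cong λ i →
    cong ⟦_⟧ (does-⇔ (mk⇔ (λ (a , e) → adj-sym a , sym e) (λ (a , e) → adj-sym a , sym e))
      (adj? i j ×-dec (lookup x j ≟ˢ lookup y i))
      (adj? j i ×-dec (lookup y i ≟ˢ lookup x j))))

  totalGain totalCost : Configuration n → Configuration n → ℕ
  totalGain x y = ∑ λ i → gain (lookup x i) (lookup y i)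
  totalCost x y = ∑ λ i → cost (degree i) (lookup x i) (lookup y i)

  Φ : Configuration n → ℕ
  Φ x = ∑ λ i → φ (op x i)

  step-balance : ∀ x → Φ x + totalCost x (step x) ≡ agreement x (step x) + totalGain x (step x)
  step-balance x = trans (sym (∑-+ _ _)) (trans (∑-cong pointwise) (∑-+ _ _))
    where
    pointwise : ∀ i → let u = lookup x i; s = lookup (step x) i in
      φ (op x i) + cost (degree i) u s ≡ agreeing x i s + gain u s
    pointwise i
      -- Bring the goal to the form of the local rule: the new state as `next`, `op` as the count of
      -- the opposite state, the degree as the sum of both counts.
      rewrite lookup∘tabulate (λ i → next (op x i) (lookup x i)) i
            | op≡agreeing-opposite x i
            | sym (degree-split x i (lookup x i))
      = next-balance (agreeing x i) (lookup x i)

  -- Here `y` is the current configuration and `x` an arbitrary competitor of its successor.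
  step-optimal : ∀ y x →
    agreement y x + totalGain y x + distance x (step y) ≤ Φ y + totalCost y x
  step-optimal y x = begin
    agreement y x + totalGain y x + distance x (step y)
      ≡⟨ cong (_+ distance x (step y)) (∑-+ _ _) ⟨
    ∑ (λ i → agreeing y i (lookup x i) + gain (lookup y i) (lookup x i)) + distance x (step y)
      ≡⟨ ∑-+ _ _ ⟨
    ∑ (λ i → agreeing y i (lookup x i) + gain (lookup y i) (lookup x i)
             + ⟦ does (¬? (lookup x i ≟ˢ lookup (step y) i)) ⟧)
      ≤⟨ ∑-mono-≤ pointwise ⟩
    ∑ (λ i → φ (op y i) + cost (degree i) (lookup y i) (lookup x i))
      ≡⟨ ∑-+ _ _ ⟩
    Φ y + totalCost y x ∎
    where
    open ≤-Reasoning
    pointwise : ∀ i → let u = lookup y i; s = lookup x i in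
      agreeing y i s + gain u s + ⟦ does (¬? (s ≟ˢ lookup (step y) i)) ⟧
        ≤ φ (op y i) + cost (degree i) u s
    pointwise i
      rewrite lookup∘tabulate (λ i → next (op y i) (lookup y i)) i
            | op≡agreeing-opposite y i
            | sym (degree-split y i (lookup y i))
      = next-optimal (agreeing y i) (lookup y i) (lookup x i)

  -- The predecessor `x` competes with the successor of `y`. By symmetry its value there is the one
  -- that `step-balance` gives for `Φ x`, and the common cost cancels.
  Φ-step : ∀ x → Φ x + distance x (step (step x)) ≤ Φ (step x)
  Φ-step x = +-cancelʳ-≤ (totalCost x y) _ _ (begin
    Φ x + δ + totalCost x y             ≡⟨ swapʳ (Φ x) δ (totalCost x y) ⟩
    Φ x + totalCost x y + δ             ≡⟨ cong (_+ δ) (step-balance x) ⟩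
    agreement x y + totalGain x y + δ   ≡⟨ cong (_+ δ) (cong₂ _+_ (agreement-sym x y)
                                             (∑-cong λ i → gain-sym (lookup x i) (lookup y i))) ⟩
    agreement y x + totalGain y x + δ   ≤⟨ step-optimal y x ⟩
    Φ y + totalCost y x                 ≡⟨ cong (Φ y +_)
                                             (∑-cong λ i → cost-sym (degree i) (lookup y i) (lookup x i)) ⟩
    Φ y + totalCost x y                 ∎)
    where
    open ≤-Reasoning
    y = step x
    δ = distance x (step y)
    swapʳ : ∀ a b c → a + b + c ≡ a + c + b
    swapʳ = solve-∀

  n≤Φ : ∀ x → n ≤ Φ x
  n≤Φ x = subst (_≤ Φ x) (∑-one n) (∑-mono-≤ λ i → φ-positive (op x i))

  Φ≤E+n : ∀ x₀ t → Φ (config x₀ t) ≤ E x₀ t + n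
  Φ≤E+n x₀ t = begin
    Φ x                                   ≤⟨ ∑-mono-≤ (φ-upper ∘ op x) ⟩
    ∑ (λ i → excess i + deficit i + 1)    ≡⟨ ∑-+ _ _ ⟩
    ∑ (λ i → excess i + deficit i) + ∑ (λ _ → 1)
      ≡⟨ cong₂ _+_ (∑-+ excess deficit) (∑-one n) ⟩
    ∑ excess + ∑ deficit + n
      ≡⟨ cong (_+ n) (cong₂ _+_ (sum-map-filter-tabulate (λ i → k ≤? op x i) _ id)
                                (sum-map-filter-tabulate (λ i → op x i <? k) _ id)) ⟨
    E x₀ t + n                            ∎
    where
    open ≤-Reasoning
    x = config x₀ t
    excess deficit : Fin n → ℕ
    excess i  = if does (k ≤? op x i) then op x i ∸ k else 0
    deficit i = if does (op x i <? k) then k ∸ op x i else 0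

  Φ-monotone : ∀ x₀ t s → Φ (config x₀ t) ≤ Φ (config x₀ (s + t))
  Φ-monotone x₀ t zero    = ≤-refl
  Φ-monotone x₀ t (suc s) =
    ≤-trans (Φ-monotone x₀ t s) (≤-trans (m≤m+n _ _) (Φ-step (config x₀ (s + t))))

  -- Φ starts at no less than `n` and gains at least one per step. The initial `n` later cancels the
  -- `n` of `Φ≤E+n`.
  Φ-growth : ∀ x₀ τ → (∀ t → t < τ → config x₀ (2 + t) ≢ config x₀ t) →
    τ + n ≤ Φ (config x₀ τ)
  Φ-growth x₀ zero    aperiodic = n≤Φ x₀
  Φ-growth x₀ (suc τ) aperiodic = begin
    suc (τ + n)                             ≡⟨ +-comm 1 (τ + n) ⟩
    τ + n + 1                               ≤⟨ +-mono-≤ (Φ-growth x₀ τ (λ t → aperiodic t ∘ m<n⇒m<1+n))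
                                                 (distance-positive x _ (aperiodic τ ≤-refl ∘ sym)) ⟩
    Φ x + distance x (step (step x))        ≤⟨ Φ-step x ⟩
    Φ (step x)                              ∎
    where
    open ≤-Reasoning
    x = config x₀ τ

theorem4 : ∀ {n : ℕ} (G : SimpleGraph n) (k : ℕ) → 1 ≤ n → 1 ≤ k →
    let open Process G k in
    ∀ (x₀ : Configuration n) (p τ : ℕ) → IsPeriodAndTransient x₀ p τ →
    ∀ (tmax : ℕ) → EnergyConstantFrom x₀ tmax →
    τ ≤ (E x₀ tmax + n) ∸ 1
theorem4 {n} G k 1≤n _ x₀ p τ period tmax constant =
  -- Cancelling `n` leaves τ ≤ E(tmax). As n ≥ 1, the truncated subtraction acts on `n` alone, and n
  -- - 1 is added as slack.
  ≤-trans (+-cancelʳ-≤ n _ _ τ+n≤E+n) (≤-trans (m≤m+n _ (n ∸ 1)) (≤-reflexive (sym (+-∸-assoc _ 1≤n))))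
  where
  open Process G k
  open IsPeriodAndTransient period
  open Potential G k
  open ≤-Reasoning

  aperiodic : ∀ t → t < τ → config x₀ (2 + t) ≢ config x₀ t
  aperiodic t t<τ = subst (λ s → config x₀ s ≢ config x₀ t) (+-comm t 2)
    -- Before `τ` every positive lag is excluded, so lag two may be taken whatever `p` is.
    (minimal t 2 (s≤s z≤n) (inj₁ t<τ))

  τ+n≤E+n : τ + n ≤ E x₀ tmax + n
  τ+n≤E+n = begin
    τ + n                    ≤⟨ Φ-growth x₀ τ aperiodic ⟩
    -- The time `tmax + τ` lies past both: Φ has kept its growth up to `τ`, and `E` has its final
    -- value.
    Φ (config x₀ τ)          ≤⟨ Φ-monotone x₀ τ tmax ⟩
    Φ (config x₀ (tmax + τ)) ≤⟨ Φ≤E+n x₀ (tmax + τ) ⟩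
    E x₀ (tmax + τ) + n      ≡⟨ cong (_+ n) (constant (tmax + τ) (m≤m+n tmax τ)) ⟩
    E x₀ tmax + n            ∎
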